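{- For every AT-free graph $G$, $\operatorname{box}(G)\le 3\Delta(G)$, where $\Delta(G)$ is the maximum degree of $G$.
   Context: An asteroidal triple in $G$ is an independent set of three vertices such that each pair is joined by a path avoiding the (closed) neighborhood of the third; $G$ is AT-free if it has no asteroidal triple. The boxicity $\operatorname{box}(G)$ is the minimum $b$ such that $G$ is the intersection graph of axis-parallel boxes in $\mathbb{R}^b$ (products of $b$ closed intervals), one box per vertex.
   Formalization: Edgeless graphs with at least two vertices are excluded: they are AT-free with Δ(G) = 0 but have boxicity 1, so the bound box(G) ≤ 3Δ(G) fails for them. -}

module Defs where

open import Level using (0ℓ)
open import Data.Fin using (Fin)
open import Data.List using (List; []; _∷_; length; filter; map; allFin)
open import Data.List.Extrema.Nat using (max)
open import Data.List.Relation.Unary.All using (All)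
open import Data.List.Relation.Unary.Unique.Propositional using (Unique)
open import Data.Nat using (ℕ; _≤_)
open import Data.Product using (Σ; ∃; ∃-syntax; _×_)
open import Data.Rational using (ℚ) renaming (_<_ to _<ℚ_)
open import Data.Sum using (_⊎_)
open import Function.Bundles using (_⇔_)
open import Relation.Binary using (Rel; Decidable; Symmetric)
open import Relation.Binary.PropositionalEquality using (_≡_; _≢_)
open import Relation.Nullary using (¬_)

-- Real numbers as two-sided Dedekind cuts of ℚ: Lower q means q < x,
-- Upper q means x < q.
record ℝ : Set₁ where
  field
    Lower          : ℚ → Set
    Upper          : ℚ → Set
    lower-nonempty : ∃ Lower
    upper-nonempty : ∃ Upper
    lower-closed   : ∀ {q r} → q <ℚ r → Lower r → Lower q
    upper-closed   : ∀ {q r} → q <ℚ r → Upper q → Upper r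
    lower-open     : ∀ {q} → Lower q → ∃[ r ] (q <ℚ r × Lower r)
    upper-open     : ∀ {r} → Upper r → ∃[ q ] (q <ℚ r × Upper q)
    disjoint       : ∀ {q} → ¬ (Lower q × Upper q)
    located        : ∀ {q r} → q <ℚ r → Lower q ⊎ Upper r

infix 4 _≤ℝ_

_≤ℝ_ : ℝ → ℝ → Set
x ≤ℝ y = ∀ {q} → ℝ.Lower x q → ℝ.Lower y q

record Graph : Set₁ where
  infix 4 _~_ _~?_
  field
    order    : ℕ
    _~_      : Rel (Fin order) 0ℓ
    _~?_     : Decidable _~_
    ~-sym    : Symmetric _~_
    ~-irrefl : ∀ {v} → ¬ (v ~ v)

  Vertex : Set
  Vertex = Fin order

  degree : Vertex → ℕ
  degree v = length (filter (v ~?_) (allFin order))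

  -- Equal to 0 for the graph with no vertices.
  Δ : ℕ
  Δ = max 0 (map degree (allFin order))

  data Walk : Vertex → Vertex → Set where
    [_]    : ∀ v → Walk v v
    _∷⟨_⟩_ : ∀ u {v w} → u ~ v → Walk v w → Walk u w

  vertices : ∀ {u v} → Walk u v → List Vertex
  vertices [ v ]          = v ∷ []
  vertices (u ∷⟨ _ ⟩ p)   = u ∷ vertices p

  IsPath : ∀ {u v} → Walk u v → Set
  IsPath p = Unique (vertices p)

  _∈N[_] : Vertex → Vertex → Set
  u ∈N[ v ] = u ≡ v ⊎ u ~ v

  JoinedAvoiding : Vertex → Vertex → Vertex → Set
  JoinedAvoiding z x y =
    Σ (Walk x y) λ p → IsPath p × All (λ v → ¬ (v ∈N[ z ])) (vertices p)

  record AsteroidalTriple (x y z : Vertex) : Set where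
    field
      x≢y : x ≢ y
      y≢z : y ≢ z
      x≢z : x ≢ z
      x≁y : ¬ (x ~ y)
      y≁z : ¬ (y ~ z)
      x≁z : ¬ (x ~ z)
      xy-avoiding-z : JoinedAvoiding z x y
      yz-avoiding-x : JoinedAvoiding x y z
      xz-avoiding-y : JoinedAvoiding y x z

  ATFree : Set
  ATFree = ∀ x y z → ¬ AsteroidalTriple x y z

record Box (b : ℕ) : Set₁ where
  field
    lo    : Fin b → ℝ
    hi    : Fin b → ℝ
    lo≤hi : ∀ i → lo i ≤ℝ hi i

_∈Box_ : ∀ {b} → (Fin b → ℝ) → Box b → Set
p ∈Box B = ∀ i → Box.lo B i ≤ℝ p i × p i ≤ℝ Box.hi B i

Intersect : ∀ {b} → Box b → Box b → Set₁
Intersect {b} A B = Σ (Fin b → ℝ) λ p → p ∈Box A × p ∈Box B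

-- ℝ⁰ is a single point, so dimension 0 represents exactly the complete graphs.
BoxRepresentable : Graph → ℕ → Set₁
BoxRepresentable G b =
  Σ (Vertex → Box b) λ B → ∀ u v → u ≢ v → (u ~ v) ⇔ Intersect (B u) (B v)
  where open Graph G

IsBoxicity : Graph → ℕ → Set₁
IsBoxicity G b = BoxRepresentable G b × (∀ c → BoxRepresentable G c → b ≤ c)

{-# OPTIONS --safe #-}

-- In an AT-free graph every independent set A can be ordered linearly so that, for
-- x < y < z in A, the vertices x and z lie in different components of G − N[y].  With
-- the elements of A as points on a line in this order, each vertex outside N[a] lies to
-- the left or to the right of a ∈ A according to its component of G − N[a]; this yields
-- an interval supergraph of G that contains no non-edge of G with an end in A.  The
-- classes of a greedy colouring with Δ + 1 colours therefore give box(G) ≤ Δ + 1 ≤ 3Δ.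
--
-- A box representation in dimension c amounts to c interval orders inside non-adjacency
-- that together compare all non-adjacent pairs.  Existence of such orders is decidable,
-- which makes the minimum b computable and allows reasoning under double negation.
module Submission where

open import Data.Bool using (Bool; true; false; T)
open import Data.Bool.Properties using (T?)
open import Data.Empty using (⊥)
open import Data.Fin using (Fin; zero; suc)
open import Data.Fin.Properties as Fin using (_≟_; pigeonhole; ¬∀⟶∃¬; <⇒≢)
open import Data.Integer as ℤ using (+_)
import Data.Integer.Properties as ℤ
open import Data.List as List using (List; []; _∷_; [_]; _++_; length; filter; map; allFin; cartesianProduct)
open import Data.List.Extrema.Nat using (argmax; argmax-sel; f[⊥]≤f[argmax]; f[xs]≤f[argmax]; xs≤max)
open import Data.List.Membership.DecPropositional using (_∈?_)
open import Data.List.Membership.Propositional using (_∈_; _∉_; lose; find)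
open import Data.List.Membership.Propositional.Properties using (∈-filter⁺; ∈-filter⁻; ∈-++⁻; ∈-++⁺ˡ; ∈-cartesianProduct⁺; ∈-cartesianProduct⁻; ∈-map⁺; ∈-allFin)
open import Data.List.Properties using (length-filter; filter-notAll; length-map; ++-assoc; ++-identityʳ)
open import Data.List.Relation.Binary.Permutation.Propositional using (_↭_; refl; prep; swap; ↭-sym; ↭-trans; ↭-reflexive)
open import Data.List.Relation.Binary.Permutation.Propositional.Properties using (shift; ∈-resp-↭; ++⁺; ++⁺ˡ; ++-comm)
open import Data.List.Relation.Unary.All as All using (All; []; _∷_)
import Data.List.Relation.Unary.All.Properties as All
open import Data.List.Relation.Unary.AllPairs using (AllPairs; []; _∷_)
import Data.List.Relation.Unary.AllPairs.Properties as AllPairs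
open import Data.List.Relation.Unary.Any using (Any; here; there; any?; index)
open import Data.List.Relation.Unary.Any.Properties using (lookup-index)
open import Data.List.Relation.Unary.Unique.Propositional using (Unique)
import Data.List.Relation.Unary.Unique.Propositional.Properties as Unique
open import Data.Nat using (ℕ; zero; suc; _+_; _*_; _⊔_; _≤_; _<_; _≤?_; z≤n; s≤s)
open import Data.Nat.Coprimality as Coprimality using (1-coprimeTo)
open import Data.Nat.Properties as ℕ using (≤-refl; ≤-trans; ≤-pred; m≤n⇒m≤1+n; <⇒≱)
open import Data.Product using (Σ; ∃; ∃-syntax; _×_; _,_; proj₁; proj₂; map₂)
open import Data.Rational as ℚ using (ℚ; mkℚ; *<*)
import Data.Rational.Properties as ℚ
open import Data.Sum as Sum using (_⊎_; inj₁; inj₂; [_,_]′)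
open import Data.Unit using (⊤)
open import Data.Vec using (Vec; []; _∷_; lookup; tabulate)
open import Data.Vec.Properties using (lookup∘tabulate)
open import Function using (_∘_; id; case_of_)
open import Function.Bundles using (mk⇔; Equivalence)
open import Relation.Binary using (DecidableEquality; tri<; tri≈; tri>)
open import Relation.Binary.PropositionalEquality using (_≡_; _≢_; refl; sym; trans; cong; subst; subst₂)
open import Relation.Nullary using (¬_; Dec; yes; no; contradiction)
open import Relation.Nullary.Decidable using (decidable-stable; map′; isYes; toWitness; fromWitness; ¬¬-excluded-middle; ¬?; _⊎-dec_; _×-dec_; _→-dec_)
open import Relation.Nullary.Negation using (¬¬-map)
open import Relation.Unary using (Decidable)
open import Defs

-- Counting in finite lists and maximal choices.

module _ {X : Set} {P Q : X → Set} (P? : Decidable P) (Q? : Decidable Q) where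

  length-filter-mono-≤ : ∀ xs → (∀ {a} → a ∈ xs → P a → Q a) →
                         length (filter P? xs) ≤ length (filter Q? xs)
  length-filter-mono-≤ []       P⊆Q = z≤n
  length-filter-mono-≤ (x ∷ xs) P⊆Q with length-filter-mono-≤ xs (P⊆Q ∘ there) | P? x | Q? x
  ... | ih | yes _ | yes _ = s≤s ih
  ... | ih | yes p | no ¬q = contradiction (P⊆Q (here refl) p) ¬q
  ... | ih | no _  | yes _ = m≤n⇒m≤1+n ih
  ... | ih | no _  | no _  = ih

  length-filter-mono-< : ∀ xs → (∀ {a} → a ∈ xs → P a → Q a) →
                         ∀ {a} → a ∈ xs → ¬ P a → Q a →
                         length (filter P? xs) < length (filter Q? xs)
  length-filter-mono-< (x ∷ xs) P⊆Q (here refl) ¬p q with P? x | Q? x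
  ... | yes p | _     = contradiction p ¬p
  ... | no _  | yes _ = s≤s (length-filter-mono-≤ xs (P⊆Q ∘ there))
  ... | no _  | no ¬q = contradiction q ¬q
  length-filter-mono-< (x ∷ xs) P⊆Q (there a∈xs) ¬p q
    with length-filter-mono-< xs (P⊆Q ∘ there) a∈xs ¬p q | P? x | Q? x
  ... | ih | yes _ | yes _ = s≤s ih
  ... | ih | yes p | no ¬q = contradiction (P⊆Q (here refl) p) ¬q
  ... | ih | no _  | yes _ = m≤n⇒m≤1+n ih
  ... | ih | no _  | no _  = ih

module _ {X : Set} {P : X → Set} (P? : Decidable P) where

  filter-split-↭ : ∀ xs → xs ↭ filter P? xs ++ filter (¬? ∘ P?) xs
  filter-split-↭ []       = refl
  filter-split-↭ (x ∷ xs) with P? x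
  ... | yes _ = prep x (filter-split-↭ xs)
  ... | no _  = ↭-trans (prep x (filter-split-↭ xs)) (↭-sym (shift x (filter P? xs) _))

-- Maximality comes from cardinality: an index whose set contains that of the `argmax` on `xs` and
-- has one more element there would have a strictly larger count.
∃-⊆-maximal : {I X : Set} {Q : I → X → Set} (Q? : ∀ i → Decidable (Q i))
              (xs : List X) (is : List I) {i₀ : I} → i₀ ∈ is →
              ∃[ i ] (i ∈ is × ∀ {j} → j ∈ is → (∀ {a} → a ∈ xs → Q i a → Q j a) →
                                       ∀ {a} → a ∈ xs → Q j a → Q i a)
∃-⊆-maximal {I} {X} {Q} Q? xs is@(k ∷ ks) _ = m , m∈ , maximal
  where
  size : I → ℕ
  size i = length (filter (Q? i) xs)
  m : I
  m = argmax size k ks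
  m∈ : m ∈ is
  m∈ = [ here , there ]′ (argmax-sel size k ks)
  size≤ : ∀ {j} → j ∈ is → size j ≤ size m
  size≤ (here refl) = f[⊥]≤f[argmax] {f = size} k ks
  size≤ (there j∈)  = All.lookup (f[xs]≤f[argmax] {f = size} k ks) j∈
  maximal : ∀ {j} → j ∈ is → (∀ {a} → a ∈ xs → Q m a → Q j a) →
            ∀ {a} → a ∈ xs → Q j a → Q m a
  maximal {j} j∈ m⊆j {a} a∈ qj = decidable-stable (Q? m a) λ ¬qm →
    <⇒≱ (length-filter-mono-< (Q? m) (Q? j) xs m⊆j a∈ ¬qm qj) (size≤ j∈)

-- Axioms for components of G - N[y].

-- In a graph, S y x z says that x and z lie in the same component of G − N[y];
-- in particular S y x x says that x ∉ N[y].
record SameSide (X : Set) : Set₁ where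
  field
    S          : X → X → X → Set
    S?         : ∀ y x z → Dec (S y x z)
    S-sym      : ∀ {y x z} → S y x z → S y z x
    S-trans    : ∀ {y x w z} → S y x w → S y w z → S y x z
    S-irrefl   : ∀ {y z} → ¬ S y y z
    S-swap     : ∀ {y x} → S y x x → S x y y
    S-transfer : ∀ {y x w z} → S y x x → S y w z → ¬ S y x z → S x w z
    S-atfree   : ∀ {x y z} → S x y z → S y x z → S z x y → ⊥

  S-reflˡ : ∀ {y x z} → S y x z → S y x x
  S-reflˡ s = S-trans s (S-sym s)

-- Separating orders of independent sets.

module Ordering {X : Set} (side : SameSide X) where

  open SameSide side

  Independent : List X → Set
  Independent = AllPairs (λ x y → S y x x)

  independent-↭ : ∀ {xs ys} → xs ↭ ys → Independent xs → Independent ys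
  independent-↭ refl            ind                   = ind
  independent-↭ (prep _ p)      (i ∷ ind)             =
    All.tabulate (All.lookup i ∘ ∈-resp-↭ (↭-sym p)) ∷ independent-↭ p ind
  independent-↭ (swap _ _ p)    ((i ∷ is) ∷ js ∷ ind) =
    (S-swap i ∷ All.tabulate (All.lookup js ∘ ∈-resp-↭ (↭-sym p))) ∷
    All.tabulate (All.lookup is ∘ ∈-resp-↭ (↭-sym p)) ∷ independent-↭ p ind
  independent-↭ (_↭_.trans p q) ind                   =
    independent-↭ q (independent-↭ p ind)

  independent-∈ : ∀ {xs x y} → Independent xs → x ∈ xs → y ∈ xs → x ≡ y ⊎ S y x x
  independent-∈ (i ∷ ind) (here refl) (here refl) = inj₁ refl
  independent-∈ (i ∷ ind) (here refl) (there y∈)  = inj₂ (All.lookup i y∈)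
  independent-∈ (i ∷ ind) (there x∈)  (here refl) = inj₂ (S-swap (All.lookup i x∈))
  independent-∈ (i ∷ ind) (there x∈)  (there y∈)  = independent-∈ ind x∈ y∈

  -- Since `¬ S y x z` also holds when x or z lies in N[y], this means separation by y only in
  -- conjunction with `Independent`.
  data Separating : List X → Set where
    []  : Separating []
    _∷_ : ∀ {x xs} → AllPairs (λ y z → ¬ S y x z) xs → Separating xs → Separating (x ∷ xs)

  separating-[_] : ∀ x → Separating [ x ]
  separating-[ x ] = [] ∷ []

  separating-pair : ∀ x y → Separating (x ∷ y ∷ [])
  separating-pair x y = ([] ∷ []) ∷ separating-[ y ]

  private
    allPairs-init : ∀ {R : X → X → Set} xs {y} → AllPairs R (xs ++ [ y ]) →
                    AllPairs R xs × All (λ x → R x y) xs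
    allPairs-init []       _         = [] , []
    allPairs-init (x ∷ xs) (r ∷ rs) with All.++⁻ xs r | allPairs-init xs rs
    ... | rxs , (rxy ∷ []) | ih , ihy = rxs ∷ ih , rxy ∷ ihy

    allPairs-++ : ∀ {R : X → X → Set} {xs ys} → AllPairs R xs → AllPairs R ys →
                  (∀ {x y} → x ∈ xs → y ∈ ys → R x y) → AllPairs R (xs ++ ys)
    allPairs-++ rxs rys rxy =
      AllPairs.++⁺ rxs rys (All.tabulate λ x∈ → All.tabulate λ y∈ → rxy x∈ y∈)

    allPairs-const : ∀ {R : X → X → Set} xs → (∀ {x y} → x ∈ xs → y ∈ xs → R x y) → AllPairs R xs
    allPairs-const []       r = []
    allPairs-const (x ∷ xs) r = All.tabulate (λ y∈ → r (here refl) (there y∈)) ∷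
                                allPairs-const xs (λ x∈ y∈ → r (there x∈) (there y∈))

    allPairs-map : ∀ {R R′ : X → X → Set} {xs} →
                   (∀ {x y} → x ∈ xs → y ∈ xs → R x y → R′ x y) → AllPairs R xs → AllPairs R′ xs
    allPairs-map f []       = []
    allPairs-map f (r ∷ rs) =
      All.tabulate (λ y∈ → f (here refl) (there y∈) (All.lookup r y∈)) ∷
      allPairs-map (λ x∈ y∈ → f (there x∈) (there y∈)) rs

  -- Relative to the pivot x, every element outside ls that ls sees past p ∈ ls is
  -- also reached past x (S-transfer), so only the pivot has to be compared with ls.
  separating-++ : ∀ {x ms rs} ls → x ∈ ms →
            (∀ {p} → p ∈ ls → S p x x) → (∀ {p} → p ∈ rs → S p x x) →
            (∀ {p l s} → p ∈ ms → l ∈ ls → s ∈ ms ++ rs → ¬ S p l s) →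
            (∀ {p s r} → p ∈ ms → s ∈ ls ++ ms → r ∈ rs → ¬ S p s r) →
            Separating (ls ++ [ x ]) → Separating ms → Separating (x ∷ rs) → Separating (ls ++ (ms ++ rs))
  separating-++ {x} {ms} {rs} [] x∈ms xls xrs cl cr gl gm (gx ∷ gr) = go ms gm id
    where
    go : ∀ ms′ → Separating ms′ → (∀ {p} → p ∈ ms′ → p ∈ ms) → Separating (ms′ ++ rs)
    go []        _         _   = gr
    go (m ∷ ms′) (gm ∷ g) sub =
      allPairs-++ gm
        (allPairs-map (λ p∈ r∈ ¬s s → cr x∈ms (sub (here refl)) r∈ (S-transfer (xrs p∈) s ¬s)) gx)
        (λ p∈ r∈ → cr (sub (there p∈)) (sub (here refl)) r∈)
      ∷ go ms′ g (sub ∘ there)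
  separating-++ {x} {ms} {rs} (l ∷ ls) x∈ms xls xrs cl cr (gl ∷ gls) gm gxr@(gx ∷ gr) =
    allPairs-++ (proj₁ (allPairs-init ls gl))
      (allPairs-++
        (allPairs-const ms λ p∈ s∈ → cl p∈ (here refl) (∈-++⁺ˡ s∈))
        (allPairs-map (λ p∈ r∈ ¬s s → cr x∈ms (here refl) r∈ (S-transfer (xrs p∈) s ¬s)) gx)
        (λ p∈ r∈ → cr p∈ (here refl) r∈))
      (λ {p} p∈ s∈ s → cl x∈ms (here refl) s∈
         (S-sym (S-transfer (xls (there p∈)) (S-sym s)
           (All.lookup (proj₂ (allPairs-init ls gl)) p∈ ∘ S-sym))))
    ∷ separating-++ ls x∈ms (xls ∘ there) xrs (λ p∈ l∈ → cl p∈ (there l∈))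
        (λ p∈ s∈ → cr p∈ (there s∈)) gls gm gxr

  -- The three recursions order a set freely, after a prescribed first element e, and
  -- between prescribed ends e and z.  The pivot x is chosen with a maximal side
  -- (resp. union of the sides of e and z): by S-transfer a p on neither side has the same
  -- sides as x, so the sides of x can be ordered separately from the rest.
  Order₀ Order₁ Order₂ : ℕ → Set
  Order₀ n = ∀ A → length A ≤ n → Independent A → ∃[ B ] (A ↭ B × Separating B)
  Order₁ n = ∀ e A → length A < n → Independent A →
             (∀ {a b} → a ∈ A → b ∈ A → S e a b) →
             ∃[ B ] (A ↭ B × Separating (e ∷ B))
  Order₂ n = ∀ e A z → suc (length A) < n → Independent A →
             (∀ {a} → a ∈ A → S e a z) → (∀ {a} → a ∈ A → S z a e) →
             ∃[ B ] (A ↭ B × Separating (e ∷ B ++ [ z ]))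

  -- The pair (x, c) makes the side of x containing c maximal on A. This side `R` goes last,
  -- everything else (including x) first. For p in `M`, `S-transfer` shows that the side of p
  -- containing c includes that of x, so by maximality they agree on A, and p has no element of `M`
  -- on the side of `R`.
  order₀-step : ∀ {n} → Order₀ n → Order₁ (suc n) → Order₀ (suc n)
  order₀-step order₀ order₁ []       _   _   = [] , refl , []
  order₀-step order₀ order₁ (x ∷ []) _   _   = [ x ] , refl , separating-[ x ]
  order₀-step {n} order₀ order₁ A@(a₁ ∷ a₂ ∷ A′) len ind@((i ∷ _) ∷ _)
    with ∃-⊆-maximal {Q = λ (x , c) a → S x a c} (λ (x , c) a → S? x a c) A
           (filter (λ (x , c) → S? x c c) (cartesianProduct A A))
           (∈-filter⁺ (λ (x , c) → S? x c c) {xs = cartesianProduct A A}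
             -- With two elements in A a candidate exists: the second one, with its side containing
             -- the first.
             (∈-cartesianProduct⁺ {xs = A} {ys = A} (there (here refl)) (here refl)) i)
  ... | (x , c) , xc∈ , maximal
    with ∈-filter⁻ (λ (x , c) → S? x c c) {xs = cartesianProduct A A} xc∈
  ... | xc∈′ , Sxcc with ∈-cartesianProduct⁻ A A xc∈′
  ... | x∈ , c∈ = BM ++ BR , A↭ , good
    where
    Q? = λ a → S? x a c
    R = filter Q? A
    M = filter (¬? ∘ Q?) A
    inR : ∀ {a} → a ∈ R → a ∈ A × S x a c
    inR = ∈-filter⁻ Q?
    inM : ∀ {a} → a ∈ M → a ∈ A × ¬ S x a c
    inM = ∈-filter⁻ (¬? ∘ Q?)
    -- As x is not in `R`, the set `R` with x as prescribed end still fits the bound for A; as c is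
    -- not in `M`, that set is strictly shorter than A.
    rec-R = order₁ x R
      (≤-trans (filter-notAll Q? A (lose x∈ S-irrefl)) len)
      (AllPairs.filter⁺ Q? ind)
      (λ a∈ b∈ → S-trans (proj₂ (inR a∈)) (S-sym (proj₂ (inR b∈))))
    rec-M = order₀ M
      (≤-pred (≤-trans (filter-notAll (¬? ∘ Q?) A (lose c∈ λ ¬s → ¬s Sxcc)) len))
      (AllPairs.filter⁺ (¬? ∘ Q?) ind)
    BR = proj₁ rec-R
    BM = proj₁ rec-M
    fromR : ∀ {a} → a ∈ BR → a ∈ A × S x a c
    fromR = inR ∘ ∈-resp-↭ (↭-sym (proj₁ (proj₂ rec-R)))
    fromM : ∀ {a} → a ∈ BM → a ∈ A × ¬ S x a c
    fromM = inM ∘ ∈-resp-↭ (↭-sym (proj₁ (proj₂ rec-M)))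
    A↭ : A ↭ BM ++ BR
    A↭ = ↭-trans (filter-split-↭ Q? A) (↭-trans (++-comm R M)
           (++⁺ (proj₁ (proj₂ rec-M)) (proj₁ (proj₂ rec-R))))
    expand : ∀ {p} → p ∈ BM → ∀ {a} → S x a c → S p a c
    expand p∈ s with independent-∈ ind (proj₁ (fromM p∈)) x∈
    ... | inj₁ refl = s
    ... | inj₂ Sxpp = S-transfer Sxpp s (proj₂ (fromM p∈))
    separated : ∀ {p s r} → p ∈ BM → s ∈ BM → r ∈ BR → ¬ S p s r
    separated p∈ s∈ r∈ Spsr = proj₂ (fromM s∈)
      (maximal
        (∈-filter⁺ (λ (x , c) → S? x c c) {xs = cartesianProduct A A}
          (∈-cartesianProduct⁺ (proj₁ (fromM p∈)) c∈) (expand p∈ Sxcc))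
        (λ _ → expand p∈) (proj₁ (fromM s∈)) (S-trans Spsr (expand p∈ (proj₂ (fromR r∈)))))
    good : Separating (BM ++ BR)
    good = separating-++ [] (∈-resp-↭ (proj₁ (proj₂ rec-M)) (∈-filter⁺ (¬? ∘ Q?) x∈ S-irrefl))
      (λ ()) (λ r∈ → S-swap (S-reflˡ (proj₂ (fromR r∈)))) (λ _ ()) separated
      separating-[ x ] (proj₂ (proj₂ rec-M)) (proj₂ (proj₂ rec-R))

  -- The pivot x has a maximal side containing e. The elements `L` of that side can be ordered
  -- between e and x, because all of A lies on one side of e; the rest `M` follows them, and
  -- maximality keeps `M` off the e-side of each of its members.
  order₁-step : ∀ {n} → Order₀ n → Order₂ (suc n) → Order₁ (suc n)
  order₁-step order₀ order₂ e [] len ind one = [] , refl , separating-[ e ]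
  order₁-step {n} order₀ order₂ e A@(a₁ ∷ A′) len ind one
    with ∃-⊆-maximal {Q = λ x a → S x a e} (λ x a → S? x a e) A A (here refl)
  ... | x , x∈ , maximal = BL ++ BM , A↭ , good
    where
    Q? = λ a → S? x a e
    L = filter Q? A
    M = filter (¬? ∘ Q?) A
    inL : ∀ {a} → a ∈ L → a ∈ A × S x a e
    inL = ∈-filter⁻ Q?
    inM : ∀ {a} → a ∈ M → a ∈ A × ¬ S x a e
    inM = ∈-filter⁻ (¬? ∘ Q?)
    rec-L = order₂ e L x
      (≤-trans (s≤s (filter-notAll Q? A (lose x∈ S-irrefl))) len)
      (AllPairs.filter⁺ Q? ind)
      (λ a∈ → one (proj₁ (inL a∈)) x∈) (λ a∈ → proj₂ (inL a∈))
    rec-M = order₀ M (≤-trans (length-filter (¬? ∘ Q?) A) (≤-pred len))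
      (AllPairs.filter⁺ (¬? ∘ Q?) ind)
    BL = proj₁ rec-L
    BM = proj₁ rec-M
    fromL : ∀ {a} → a ∈ BL → a ∈ A × S x a e
    fromL = inL ∘ ∈-resp-↭ (↭-sym (proj₁ (proj₂ rec-L)))
    fromM : ∀ {a} → a ∈ BM → a ∈ A × ¬ S x a e
    fromM = inM ∘ ∈-resp-↭ (↭-sym (proj₁ (proj₂ rec-M)))
    A↭ : A ↭ BL ++ BM
    A↭ = ↭-trans (filter-split-↭ Q? A) (++⁺ (proj₁ (proj₂ rec-L)) (proj₁ (proj₂ rec-M)))
    expand : ∀ {p} → p ∈ BM → ∀ {a} → S x a e → S p a e
    expand p∈ s with independent-∈ ind (proj₁ (fromM p∈)) x∈
    ... | inj₁ refl = s
    ... | inj₂ Sxpp = S-transfer Sxpp s (proj₂ (fromM p∈))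
    avoid : ∀ {l} → l ∈ e ∷ BL → S l x x
    avoid (here refl) = one x∈ x∈
    avoid (there l∈)  = S-swap (S-reflˡ (proj₂ (fromL l∈)))
    toward-e : ∀ {p l} → p ∈ BM → l ∈ e ∷ BL → S p l e
    toward-e p∈ (here refl) = S-swap (one (proj₁ (fromM p∈)) (proj₁ (fromM p∈)))
    toward-e p∈ (there l∈)  = expand p∈ (proj₂ (fromL l∈))
    separated : ∀ {p l s} → p ∈ BM → l ∈ e ∷ BL → s ∈ BM ++ [] → ¬ S p l s
    separated p∈ l∈ s∈ Spls with ∈-++⁻ BM s∈
    ... | inj₁ s∈ = proj₂ (fromM s∈)
      (maximal (proj₁ (fromM p∈)) (λ _ → expand p∈) (proj₁ (fromM s∈))
        (S-trans (S-sym Spls) (toward-e p∈ l∈)))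
    good : Separating (e ∷ BL ++ BM)
    good = subst (λ ms → Separating (e ∷ BL ++ ms)) (++-identityʳ BM)
      (separating-++ (e ∷ BL) (∈-resp-↭ (proj₁ (proj₂ rec-M)) (∈-filter⁺ (¬? ∘ Q?) x∈ S-irrefl))
        avoid (λ ()) separated (λ _ _ ())
        (proj₂ (proj₂ rec-L)) (proj₂ (proj₂ rec-M)) separating-[ x ])

  -- The part `L` of A on the e-side of x is ordered between e and x, the part `R` on the z-side
  -- between x and z, and the rest `M` is placed in the middle. By maximality no member of `M` has
  -- another one on its e-side or its z-side.
  order₂-step : ∀ {n} → Order₀ n → Order₂ n → Order₂ (suc n)
  order₂-step order₀ order₂ e [] z len ind toz toe = [] , refl , separating-pair e z
  order₂-step {n} order₀ order₂ e A@(a₁ ∷ A′) z len ind toz toe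
    with ∃-⊆-maximal {Q = λ x a → S x a e ⊎ S x a z} (λ x a → S? x a e ⊎-dec S? x a z) A A (here refl)
  ... | x , x∈ , maximal = BL ++ (BM ++ BR) , A↭ , good
    where
    Q? = λ a → S? x a e ⊎-dec S? x a z
    E? = λ a → S? x a e
    L = filter E? (filter Q? A)
    R = filter (¬? ∘ E?) (filter Q? A)
    M = filter (¬? ∘ Q?) A
    ¬Qx : ¬ (S x x e ⊎ S x x z)
    ¬Qx = [ S-irrefl , S-irrefl ]′
    -- AT-freeness enters the ordering only here: otherwise p, e and z would form an asteroidal
    -- triple.
    separates : ∀ {p} → p ∈ A → ¬ S p e z
    separates p∈ Spez = S-atfree Spez (toz p∈) (toe p∈)
    inL : ∀ {a} → a ∈ L → a ∈ A × S x a e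
    inL a∈ with ∈-filter⁻ E? a∈
    ... | a∈′ , s = proj₁ (∈-filter⁻ Q? {xs = A} a∈′) , s
    inR : ∀ {a} → a ∈ R → a ∈ A × S x a z
    inR a∈ with ∈-filter⁻ (¬? ∘ E?) {xs = filter Q? A} a∈
    ... | a∈′ , ¬s with ∈-filter⁻ Q? {xs = A} a∈′
    ... | a∈A , inj₁ s = contradiction s ¬s
    ... | a∈A , inj₂ s = a∈A , s
    inM : ∀ {a} → a ∈ M → a ∈ A × ¬ (S x a e ⊎ S x a z)
    inM = ∈-filter⁻ (¬? ∘ Q?)
    shorter : ∀ {m} → m ≤ length (filter Q? A) → suc m < n
    shorter m≤ = ≤-pred (≤-trans (s≤s (s≤s (≤-trans (s≤s m≤) (filter-notAll Q? A (lose x∈ ¬Qx))))) len)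
    rec-L = order₂ e L x (shorter (length-filter E? (filter Q? A)))
      (AllPairs.filter⁺ E? (AllPairs.filter⁺ Q? ind))
      (λ a∈ → S-trans (toz (proj₁ (inL a∈))) (S-sym (toz x∈)))
      (λ a∈ → proj₂ (inL a∈))
    rec-R = order₂ x R z (shorter (length-filter (¬? ∘ E?) (filter Q? A)))
      (AllPairs.filter⁺ (¬? ∘ E?) (AllPairs.filter⁺ Q? ind))
      (λ a∈ → proj₂ (inR a∈))
      (λ a∈ → S-trans (toe (proj₁ (inR a∈))) (S-sym (toe x∈)))
    rec-M = order₀ M
      (≤-trans (length-filter (¬? ∘ Q?) A) (≤-pred (≤-trans (m≤n⇒m≤1+n ≤-refl) len)))
      (AllPairs.filter⁺ (¬? ∘ Q?) ind)
    BL = proj₁ rec-L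
    BM = proj₁ rec-M
    BR = proj₁ rec-R
    fromL : ∀ {a} → a ∈ BL → a ∈ A × S x a e
    fromL = inL ∘ ∈-resp-↭ (↭-sym (proj₁ (proj₂ rec-L)))
    fromR : ∀ {a} → a ∈ BR → a ∈ A × S x a z
    fromR = inR ∘ ∈-resp-↭ (↭-sym (proj₁ (proj₂ rec-R)))
    fromM : ∀ {a} → a ∈ BM → a ∈ A × ¬ (S x a e ⊎ S x a z)
    fromM = inM ∘ ∈-resp-↭ (↭-sym (proj₁ (proj₂ rec-M)))
    A↭ : A ↭ BL ++ (BM ++ BR)
    A↭ = ↭-trans (filter-split-↭ Q? A)
      (↭-trans (++⁺ (filter-split-↭ E? (filter Q? A)) (proj₁ (proj₂ rec-M)))
      (↭-trans (↭-reflexive (++-assoc L R BM))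
      (++⁺ (proj₁ (proj₂ rec-L)) (↭-trans (++-comm R BM) (++⁺ˡ BM (proj₁ (proj₂ rec-R)))))))
    expand-e : ∀ {p} → p ∈ BM → ∀ {a} → S x a e → S p a e
    expand-e p∈ s with independent-∈ ind (proj₁ (fromM p∈)) x∈
    ... | inj₁ refl = s
    ... | inj₂ Sxpp = S-transfer Sxpp s (proj₂ (fromM p∈) ∘ inj₁)
    expand-z : ∀ {p} → p ∈ BM → ∀ {a} → S x a z → S p a z
    expand-z p∈ s with independent-∈ ind (proj₁ (fromM p∈)) x∈
    ... | inj₁ refl = s
    ... | inj₂ Sxpp = S-transfer Sxpp s (proj₂ (fromM p∈) ∘ inj₂)
    neither : ∀ {p s} → p ∈ BM → s ∈ BM → ¬ (S p s e ⊎ S p s z)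
    neither p∈ s∈ q = proj₂ (fromM s∈)
      (maximal (proj₁ (fromM p∈)) (λ _ → Sum.map (expand-e p∈) (expand-z p∈)) (proj₁ (fromM s∈)) q)
    avoid-L : ∀ {l} → l ∈ e ∷ BL → S l x x
    avoid-L (here refl) = S-reflˡ (toz x∈)
    avoid-L (there l∈)  = S-swap (S-reflˡ (proj₂ (fromL l∈)))
    avoid-R : ∀ {r} → r ∈ BR ++ [ z ] → S r x x
    avoid-R r∈ with ∈-++⁻ BR r∈
    ... | inj₁ r∈          = S-swap (S-reflˡ (proj₂ (fromR r∈)))
    ... | inj₂ (here refl) = S-reflˡ (toe x∈)
    toward-e : ∀ {p l} → p ∈ BM → l ∈ e ∷ BL → S p l e
    toward-e p∈ (here refl) = S-swap (S-reflˡ (toz (proj₁ (fromM p∈))))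
    toward-e p∈ (there l∈)  = expand-e p∈ (proj₂ (fromL l∈))
    toward-z : ∀ {p r} → p ∈ BM → r ∈ BR ++ [ z ] → S p r z
    toward-z p∈ r∈ with ∈-++⁻ BR r∈
    ... | inj₁ r∈          = expand-z p∈ (proj₂ (fromR r∈))
    ... | inj₂ (here refl) = S-swap (S-reflˡ (toe (proj₁ (fromM p∈))))
    separated-LR : ∀ {p l r} → p ∈ BM → l ∈ e ∷ BL → r ∈ BR ++ [ z ] → ¬ S p l r
    separated-LR p∈ l∈ r∈ Splr = separates (proj₁ (fromM p∈))
      (S-trans (S-sym (toward-e p∈ l∈)) (S-trans Splr (toward-z p∈ r∈)))
    separated-L : ∀ {p l s} → p ∈ BM → l ∈ e ∷ BL → s ∈ BM ++ (BR ++ [ z ]) → ¬ S p l s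
    separated-L p∈ l∈ s∈ with ∈-++⁻ BM s∈
    ... | inj₁ s∈ = λ Spls → neither p∈ s∈ (inj₁ (S-trans (S-sym Spls) (toward-e p∈ l∈)))
    ... | inj₂ r∈ = separated-LR p∈ l∈ r∈
    separated-R : ∀ {p s r} → p ∈ BM → s ∈ (e ∷ BL) ++ BM → r ∈ BR ++ [ z ] → ¬ S p s r
    separated-R p∈ s∈ r∈ with ∈-++⁻ (e ∷ BL) s∈
    ... | inj₁ l∈ = separated-LR p∈ l∈ r∈
    ... | inj₂ s∈ = λ Spsr → neither p∈ s∈ (inj₂ (S-trans Spsr (toward-z p∈ r∈)))
    reassoc : BL ++ (BM ++ (BR ++ [ z ])) ≡ (BL ++ (BM ++ BR)) ++ [ z ]
    reassoc rewrite ++-assoc BL (BM ++ BR) [ z ] | ++-assoc BM BR [ z ] = refl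
    good : Separating (e ∷ (BL ++ (BM ++ BR)) ++ [ z ])
    good = subst (λ xs → Separating (e ∷ xs)) reassoc
      (separating-++ (e ∷ BL) (∈-resp-↭ (proj₁ (proj₂ rec-M)) (∈-filter⁺ (¬? ∘ Q?) x∈ ¬Qx))
        avoid-L avoid-R separated-L separated-R
        (proj₂ (proj₂ rec-L)) (proj₂ (proj₂ rec-M)) (proj₂ (proj₂ rec-R)))

  separatingOrder : ∀ A → Independent A → ∃[ B ] (A ↭ B × Separating B)
  separatingOrder A = proj₁ (orders (length A)) A ≤-refl
    where
    -- The bound n also counts the prescribed ends. `Order₁` at `suc n` follows from `Order₀` at n
    -- and `Order₂` at `suc n`, so the induction need not carry it.
    orders : ∀ n → Order₀ n × Order₂ n
    orders zero    = (λ { [] _ _ → [] , refl , [] }) , (λ _ _ _ ())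
    orders (suc n) with orders n
    ... | order₀ , order₂ = order₀-step order₀ (order₁-step order₀ order₂′) , order₂′
      where order₂′ = order₂-step order₀ order₂

  -- The interval order given by a separating order.

  Left : X → List X → X → Set
  Left a as u = S a u u × All (λ b → ¬ S a u b) as

  Right : X → List X → X → Set
  Right a as u = Any (S a u) as

  -- The interval order in which each a of the list is a point, and a u ∉ N[a] is on the
  -- right of a exactly when its component of G − N[a] contains a later element of the list.
  _⊢_<_ : List X → X → X → Set
  []       ⊢ u < w = ⊥
  (a ∷ as) ⊢ u < w =
    (Left a as u × (w ≡ a ⊎ Right a as w)) ⊎ (u ≡ a × Right a as w) ⊎ as ⊢ u < w

  ⊢<? : DecidableEquality X → ∀ as u w → Dec (as ⊢ u < w)
  ⊢<? _≟_ []       u w = no id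
  ⊢<? _≟_ (a ∷ as) u w =
    ((S? a u u ×-dec All.all? (λ b → ¬? (S? a u b)) as) ×-dec (w ≟ a ⊎-dec any? (S? a w) as))
    ⊎-dec (u ≟ a ×-dec any? (S? a w) as) ⊎-dec ⊢<? _≟_ as u w

  LeftOfAll : List X → X → Set
  LeftOfAll []       u = ⊤
  LeftOfAll (a ∷ as) u = Left a as u × LeftOfAll as u

  leftOfAll-< : ∀ as {u c d} → LeftOfAll as u → as ⊢ c < d → as ⊢ u < d
  leftOfAll-< (a ∷ as) (l , _)  (inj₁ (_ , d))        = inj₁ (l , d)
  leftOfAll-< (a ∷ as) (l , _)  (inj₂ (inj₁ (_ , d))) = inj₁ (l , inj₂ d)
  leftOfAll-< (a ∷ as) (_ , ls) (inj₂ (inj₂ c<d))     = inj₂ (inj₂ (leftOfAll-< as ls c<d))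

  -- Let b come after a. If u were in N[b], it would share b's component of G - N[a]. If u shared a
  -- component of G - N[b] with a later c, then, as b separates a from c, their connection would
  -- miss N[a] and put u on the side of c there as well.
  left⇒leftOfAll : ∀ {a u} as → All (λ b → S b a a) as → AllPairs (λ y z → ¬ S y a z) as →
                   Left a as u → LeftOfAll as u
  left⇒leftOfAll []       _         _         _                  = _
  left⇒leftOfAll (b ∷ as) (i ∷ ind) (g ∷ gs) (Sauu , ¬s ∷ ¬ss) =
    ( S-swap (S-transfer Sauu (S-swap i) ¬s)
    , All.zipWith (λ (¬Sbac , ¬Sauc) Sbuc → ¬Sauc (S-transfer i Sbuc ¬Sbac)) (g , ¬ss) )
    , left⇒leftOfAll as ind gs (Sauu , ¬ss)

  self-leftOfAll : ∀ {a} as → All (λ b → S b a a) as → AllPairs (λ y z → ¬ S y a z) as →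
                   LeftOfAll as a
  self-leftOfAll []       _         _        = _
  self-leftOfAll (b ∷ as) (i ∷ ind) (g ∷ gs) = (i , g) , self-leftOfAll as ind gs

  -- Take the points of the list that witness the two comparisons. The lower vertex at the earlier
  -- point is that point or left of it, hence left of all later points and below the upper vertex of
  -- the other comparison. At a common point the halves recombine.
  ⊢<-ferrers : ∀ {as} → Independent as → Separating as → ∀ {u w u′ w′} →
               as ⊢ u < w → as ⊢ u′ < w′ → as ⊢ u < w′ ⊎ as ⊢ u′ < w
  ⊢<-ferrers {a ∷ as} (i ∷ ind) (g ∷ good) = ferrers
    where
    ferrers : ∀ {u w u′ w′} → (a ∷ as) ⊢ u < w → (a ∷ as) ⊢ u′ < w′ →
              (a ∷ as) ⊢ u < w′ ⊎ (a ∷ as) ⊢ u′ < w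
    ferrers (inj₁ (l , _))           (inj₁ (_ , d))           = inj₁ (inj₁ (l , d))
    ferrers (inj₁ (l , _))           (inj₂ (inj₁ (_ , d)))    = inj₁ (inj₁ (l , inj₂ d))
    ferrers (inj₂ (inj₁ (_ , d)))    (inj₁ (l , _))           = inj₂ (inj₁ (l , inj₂ d))
    ferrers (inj₂ (inj₁ (eq , _)))   (inj₂ (inj₁ (_ , d)))    = inj₁ (inj₂ (inj₁ (eq , d)))
    ferrers (inj₁ (l , _))           (inj₂ (inj₂ p))          =
      inj₁ (inj₂ (inj₂ (leftOfAll-< as (left⇒leftOfAll as i g l) p)))
    ferrers (inj₂ (inj₁ (refl , _))) (inj₂ (inj₂ p))          =
      inj₁ (inj₂ (inj₂ (leftOfAll-< as (self-leftOfAll as i g) p)))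
    ferrers (inj₂ (inj₂ p))          (inj₁ (l , _))           =
      inj₂ (inj₂ (inj₂ (leftOfAll-< as (left⇒leftOfAll as i g l) p)))
    ferrers (inj₂ (inj₂ p))          (inj₂ (inj₁ (refl , _))) =
      inj₂ (inj₂ (inj₂ (leftOfAll-< as (self-leftOfAll as i g) p)))
    ferrers (inj₂ (inj₂ p))          (inj₂ (inj₂ q))          =
      Sum.map (inj₂ ∘ inj₂) (inj₂ ∘ inj₂) (⊢<-ferrers ind good p q)

  -- In the main case u is left and w right of some a: w shares a component of G - N[a] with a later
  -- b, and u lies outside that component, so `S-transfer` keeps w out of N[u].
  ⊢<⇒independent : ∀ as {u w} → as ⊢ u < w → S w u u
  ⊢<⇒independent (a ∷ as) (inj₁ ((Sauu , _) , inj₁ refl)) = Sauu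
  ⊢<⇒independent (a ∷ as) (inj₁ ((Sauu , ¬s) , inj₂ r)) with find r
  ... | b , b∈ , Sawb = S-swap (S-transfer Sauu (S-reflˡ Sawb)
                          (λ Sauw → All.lookup ¬s b∈ (S-trans Sauw Sawb)))
  ⊢<⇒independent (a ∷ as) (inj₂ (inj₁ (refl , r))) with find r
  ... | b , b∈ , Sawb = S-swap (S-reflˡ Sawb)
  ⊢<⇒independent (a ∷ as) (inj₂ (inj₂ p)) = ⊢<⇒independent as p

  ⊢<-complete : ∀ {as a u} → a ∈ as → S a u u → as ⊢ u < a ⊎ as ⊢ a < u
  ⊢<-complete {a ∷ as} {_} {u} (here refl) Sauu with any? (S? a u) as
  ... | yes r = inj₂ (inj₂ (inj₁ (refl , r)))
  ... | no ¬r = inj₁ (inj₁ ((Sauu , All.¬Any⇒All¬ as ¬r) , inj₁ refl))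
  ⊢<-complete (there a∈) Sauu = Sum.map (inj₂ ∘ inj₂) (inj₂ ∘ inj₂) (⊢<-complete a∈ Sauu)

-- Double negation, finite search and minima.

-- This lets excluded middle be assumed for finitely many instances at once when the goal is a
-- negation.
¬¬-∀Fin : ∀ {n p} {P : Fin n → Set p} → (∀ i → ¬ ¬ P i) → ¬ ¬ (∀ i → P i)
¬¬-∀Fin {zero}  p k = k λ ()
¬¬-∀Fin {suc n} p k =
  p zero λ p₀ → ¬¬-∀Fin (p ∘ suc) λ pₛ → k λ { zero → p₀ ; (suc i) → pₛ i }

∃-∉ : ∀ {k} (cs : List (Fin (suc k))) → length cs ≤ k → ∃[ c ] c ∉ cs
∃-∉ {k} cs len = ¬∀⟶∃¬ (suc k) (_∈ cs) (λ c → _∈?_ _≟_ c cs) λ all →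
  let i , j , i<j , eq = pigeonhole (s≤s len) (index ∘ all)
  in <⇒≢ i<j (trans (lookup-index (all i))
                (trans (cong (List.lookup cs) eq) (sym (lookup-index (all j)))))

Searchable : Set → Set₁
Searchable A = {P : A → Set} → Decidable P → Dec (∃ P)

search-Bool : Searchable Bool
search-Bool P? = map′ [ (true ,_) , (false ,_) ]′
  (λ { (true , p) → inj₁ p ; (false , p) → inj₂ p }) (P? true ⊎-dec P? false)

search-Vec : ∀ {A} → Searchable A → ∀ n → Searchable (Vec A n)
search-Vec search zero    P? = map′ ([] ,_) (λ { ([] , p) → p }) (P? [])
search-Vec search (suc n) P? =
  map′ (λ (x , xs , p) → x ∷ xs , p) (λ { (x ∷ xs , p) → x , xs , p })
    (search λ x → search-Vec search n λ xs → P? (x ∷ xs))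

least : {P : ℕ → Set} → Decidable P → ∀ k → P k → ∃[ b ] (P b × b ≤ k × ∀ c → P c → b ≤ c)
least P? zero    p = zero , p , z≤n , λ _ _ → z≤n
least P? (suc k) p with P? zero
... | yes p₀ = zero , p₀ , z≤n , λ _ _ → z≤n
... | no ¬p₀ with least (P? ∘ suc) k p
...   | b , pb , b≤k , min = suc b , pb , s≤s b≤k ,
        λ { zero p₀ → contradiction p₀ ¬p₀ ; (suc c) pc → s≤s (min c pc) }

-- Connectivity outside closed neighbourhoods.

module _ (G : Graph) where

  open Graph G renaming ([_] to [_]ʷ)

  -- Walks in G - N[y] without the path condition, so that they compose freely; `connected⇒joined`
  -- restores it.
  data Connected (y : Vertex) : Vertex → Vertex → Set where
    stop : ∀ {u} → ¬ (u ∈N[ y ]) → Connected y u u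
    step : ∀ {u v w} → ¬ (u ∈N[ y ]) → u ~ v → Connected y v w → Connected y u w

  source-avoids : ∀ {y u w} → Connected y u w → ¬ (u ∈N[ y ])
  source-avoids (stop u∉)     = u∉
  source-avoids (step u∉ _ _) = u∉

  connected-trans : ∀ {y u v w} → Connected y u v → Connected y v w → Connected y u w
  connected-trans (stop _)        q = q
  connected-trans (step u∉ u~v p) q = step u∉ u~v (connected-trans p q)

  connected-sym : ∀ {y u w} → Connected y u w → Connected y w u
  connected-sym (stop u∉)       = stop u∉
  connected-sym (step u∉ u~v p) =
    connected-trans (connected-sym p) (step (source-avoids p) (~-sym u~v) (stop u∉))

  -- If the walk from w to z met N[x], then x, itself outside N[y], could follow the rest of it to
  -- z.
  connected-transfer : ∀ {y x w z} → ¬ (x ∈N[ y ]) → Connected y w z → ¬ Connected y x z →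
                       Connected x w z
  connected-transfer {y} {x} x∉ p ¬xz = go p
    where
    clear : ∀ {v} → Connected y v _ → ¬ (v ∈N[ x ])
    clear p (inj₁ refl) = ¬xz p
    clear p (inj₂ v~x)  = ¬xz (step x∉ (~-sym v~x) p)
    go : ∀ {v} → Connected y v _ → Connected x v _
    go p@(stop _)        = stop (clear p)
    go p@(step _ v~v′ q) = step (clear p) v~v′ (go q)

  ∈N-sym : ∀ {u v} → u ∈N[ v ] → v ∈N[ u ]
  ∈N-sym = Sum.map sym ~-sym

  path-suffix : ∀ {P : Vertex → Set} {u v w} (q : Walk v w) → u ∈ vertices q → IsPath q →
                All P (vertices q) → Σ (Walk u w) λ r → IsPath r × All P (vertices r)
  path-suffix q@([ _ ]ʷ)      (here refl) path     all      = q , path , all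
  path-suffix q@(_ ∷⟨ _ ⟩ _)  (here refl) path     all      = q , path , all
  path-suffix (_ ∷⟨ _ ⟩ q)    (there u∈)  (_ ∷ path) (_ ∷ all) = path-suffix q u∈ path all

  -- When the new source already occurs on the path, the path is cut to start at that occurrence.
  connected⇒joined : ∀ {y u w} → Connected y u w → JoinedAvoiding y u w
  connected⇒joined (stop u∉) = [ _ ]ʷ , [] ∷ [] , u∉ ∷ []
  connected⇒joined (step {u} u∉ u~v p) with connected⇒joined p
  ... | q , path , avoid with _∈?_ _≟_ u (vertices q)
  ...   | yes u∈ = path-suffix q u∈ path avoid
  ...   | no u∉q = (u ∷⟨ u~v ⟩ q) , All.¬Any⇒All¬ _ u∉q ∷ path , u∉ ∷ avoid

  sameSide : ATFree → (∀ y x z → Dec (Connected y x z)) → SameSide Vertex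
  sameSide atfree dec = record
    { S          = Connected
    ; S?         = dec
    ; S-sym      = connected-sym
    ; S-trans    = connected-trans
    ; S-irrefl   = λ s → source-avoids s (inj₁ refl)
    ; S-swap     = λ s → stop (source-avoids s ∘ ∈N-sym)
    ; S-transfer = connected-transfer ∘ source-avoids
    ; S-atfree   = λ {x} {y} {z} yz xz xy → atfree x y z record
        { x≢y = source-avoids xz ∘ inj₁
        ; y≢z = source-avoids (connected-sym xz) ∘ inj₁ ∘ sym
        ; x≢z = source-avoids xy ∘ inj₁
        ; x≁y = source-avoids xz ∘ inj₂
        ; y≁z = source-avoids (connected-sym xz) ∘ inj₂ ∘ ~-sym
        ; x≁z = source-avoids xy ∘ inj₂
        ; xy-avoiding-z = connected⇒joined xy
        ; yz-avoiding-x = connected⇒joined yz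
        ; xz-avoiding-y = connected⇒joined xz
        }
    }

  -- Greedy colouring.

  degree≤Δ : ∀ v → degree v ≤ Δ
  degree≤Δ v = All.lookup (xs≤max 0 (map degree (allFin order))) (∈-map⁺ degree (∈-allFin v))

  -- The new vertex w avoids the colours of all its neighbours, also of those outside `vs`, whose
  -- colours are arbitrary: there are at most Δ of them in any case.
  greedy-coloring : ∀ vs → Σ (Vertex → Fin (suc Δ)) λ color →
                    ∀ {u v} → u ∈ vs → v ∈ vs → u ~ v → color u ≢ color v
  greedy-coloring []       = (λ _ → zero) , λ ()
  greedy-coloring (w ∷ vs) with greedy-coloring vs
  ... | color , proper
    with ∃-∉ (map color (filter (w ~?_) (allFin order)))
           (subst (_≤ Δ) (sym (length-map color (filter (w ~?_) (allFin order)))) (degree≤Δ w))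
  ...   | c , c∉ = color′ , proper′
    where
    color′ : Vertex → Fin (suc Δ)
    color′ v with v ≟ w
    ... | yes _ = c
    ... | no _  = color v
    fresh : ∀ {v} → w ~ v → c ≢ color v
    fresh w~v refl = c∉ (∈-map⁺ color (∈-filter⁺ (w ~?_) (∈-allFin _) w~v))
    old : ∀ {v} → v ≢ w → v ∈ w ∷ vs → v ∈ vs
    old v≢w (here v≡w) = contradiction v≡w v≢w
    old v≢w (there v∈) = v∈
    proper′ : ∀ {u v} → u ∈ w ∷ vs → v ∈ w ∷ vs → u ~ v → color′ u ≢ color′ v
    proper′ {u} {v} u∈ v∈ u~v with u ≟ w | v ≟ w
    ... | yes refl | yes refl = contradiction u~v ~-irrefl
    ... | yes refl | no _     = fresh u~v
    ... | no _     | yes refl = fresh (~-sym u~v) ∘ sym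
    ... | no u≢w   | no v≢w   = proper (old u≢w u∈) (old v≢w v∈) u~v

  -- Covers of the non-adjacent pairs by interval orders.

  -- `sound` contains irreflexivity; with it `ferrers` is the axiom of interval orders, its instance
  -- w = u′ being transitivity.
  record IsCover {c} (P : Fin c → Vertex → Vertex → Set) : Set where
    field
      sound    : ∀ i u w → P i u w → u ≢ w × ¬ (u ~ w)
      ferrers  : ∀ i u w u′ w′ → P i u w → P i u′ w′ → P i u w′ ⊎ P i u′ w
      complete : ∀ u w → u ≢ w → ¬ (u ~ w) → ∃[ i ] (P i u w ⊎ P i w u)

  isCover? : ∀ {c} {P : Fin c → Vertex → Vertex → Set} →
             (∀ i u w → Dec (P i u w)) → Dec (IsCover P)
  isCover? P? = map′
    (λ (s , f , c) → record { sound = s ; ferrers = f ; complete = c })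
    (λ cov → let open IsCover cov in sound , ferrers , complete)
    ((Fin.all? λ i → Fin.all? λ u → Fin.all? λ w → P? i u w →-dec (¬? (u ≟ w) ×-dec ¬? (u ~? w)))
    ×-dec (Fin.all? λ i → Fin.all? λ u → Fin.all? λ w → Fin.all? λ u′ → Fin.all? λ w′ →
      P? i u w →-dec (P? i u′ w′ →-dec (P? i u w′ ⊎-dec P? i u′ w)))
    ×-dec (Fin.all? λ u → Fin.all? λ w → ¬? (u ≟ w) →-dec (¬? (u ~? w) →-dec
      Fin.any? λ i → P? i u w ⊎-dec P? i w u)))

  isCover-resp : ∀ {c} {P Q : Fin c → Vertex → Vertex → Set} →
                 (∀ {i u w} → P i u w → Q i u w) → (∀ {i u w} → Q i u w → P i u w) →
                 IsCover P → IsCover Q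
  isCover-resp P⇒Q Q⇒P cov = record
    { sound    = λ i u w q → sound i u w (Q⇒P q)
    ; ferrers  = λ i u w u′ w′ q q′ → Sum.map P⇒Q P⇒Q (ferrers i u w u′ w′ (Q⇒P q) (Q⇒P q′))
    ; complete = λ u w u≢w u≁w → map₂ (Sum.map P⇒Q P⇒Q) (complete u w u≢w u≁w)
    }
    where open IsCover cov

  Matrices : ℕ → Set
  Matrices c = Vec (Vec (Vec Bool order) order) c

  entry : ∀ {c} → Matrices c → Fin c → Vertex → Vertex → Set
  entry M i u w = T (lookup (lookup (lookup M i) u) w)

  entry? : ∀ {c} (M : Matrices c) i u w → Dec (entry M i u w)
  entry? M i u w = T? _

  -- Existence of a cover, phrased with Boolean matrices so that it is decidable.
  Coverable : ℕ → Set
  Coverable c = ∃[ M ] IsCover {c} (entry M)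

  coverable? : Decidable Coverable
  coverable? c =
    search-Vec (search-Vec (search-Vec search-Bool order) order) c λ M → isCover? (entry? M)

  isCover⇒coverable : ∀ {c} {P : Fin c → Vertex → Vertex → Set} →
                      (∀ i u w → Dec (P i u w)) → IsCover P → Coverable c
  isCover⇒coverable {P = P} P? cov = M , isCover-resp
    (λ {i} {u} {w} p → subst T (sym (entry≡ i u w)) (fromWitness p))
    (λ {i} {u} {w} t → toWitness (subst T (entry≡ i u w) t)) cov
    where
    M = tabulate λ i → tabulate λ u → tabulate λ w → isYes (P? i u w)
    entry≡ : ∀ i u w → lookup (lookup (lookup M i) u) w ≡ isYes (P? i u w)
    entry≡ i u w
      rewrite lookup∘tabulate (λ i → tabulate λ u → tabulate λ w → isYes (P? i u w)) i
            | lookup∘tabulate (λ u → tabulate λ w → isYes (P? i u w)) u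
      = lookup∘tabulate (λ w → isYes (P? i u w)) w

  -- The goal is decidable, hence stable under double negation, so connectivity in every G - N[y]
  -- may be assumed decidable.
  atfree⇒coverable : ATFree → Coverable (suc Δ)
  atfree⇒coverable atfree = decidable-stable (coverable? (suc Δ)) λ ¬cov →
    ¬¬-∀Fin (λ y → ¬¬-∀Fin λ x → ¬¬-∀Fin λ z → ¬¬-excluded-middle) λ dec →
    ¬cov (cover dec)
    where
    color = proj₁ (greedy-coloring (allFin order))
    proper : ∀ {u v} → u ~ v → color u ≢ color v
    proper = proj₂ (greedy-coloring (allFin order)) (∈-allFin _) (∈-allFin _)
    class : Fin (suc Δ) → List Vertex
    class i = filter (λ v → color v ≟ i) (allFin order)
    class⁻ : ∀ {i v} → v ∈ class i → color v ≡ i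
    class⁻ {i} v∈ = proj₂ (∈-filter⁻ (λ v → color v ≟ i) {xs = allFin order} v∈)
    cover : (∀ y x z → Dec (Connected y x z)) → Coverable (suc Δ)
    cover dec = isCover⇒coverable (λ i → ⊢<? _≟_ (line i)) record
      { sound    = λ i u w u<w → let u∉ = source-avoids (⊢<⇒independent (line i) u<w)
                                 in u∉ ∘ inj₁ , u∉ ∘ inj₂
      ; ferrers  = λ i u w u′ w′ → ⊢<-ferrers (independent i) (good i)
      -- In the order of its own colour class w is a point, and every vertex outside N[w] is left or
      -- right of it.
      ; complete = λ u w u≢w u≁w → color w ,
          ⊢<-complete (∈line w) (stop [ u≢w , u≁w ]′)
      }
      where
      open Ordering (sameSide atfree dec)
      class-independent : ∀ i → Independent (class i)
      class-independent i = independent-tabulate (class i)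
        (Unique.filter⁺ (λ v → color v ≟ i) (Unique.allFin⁺ order)) id
        where
        independent-tabulate : ∀ vs → Unique vs → (∀ {v} → v ∈ vs → v ∈ class i) → Independent vs
        independent-tabulate []       _            _   = []
        independent-tabulate (v ∷ vs) (v∉ ∷ uniq) sub =
          All.tabulate (λ w∈ → stop
            [ All.lookup v∉ w∈
            , (λ v~w → proper v~w (trans (class⁻ (sub (here refl))) (sym (class⁻ (sub (there w∈))))))
            ]′)
          ∷ independent-tabulate vs uniq (sub ∘ there)
      ordered : ∀ i → ∃[ B ] (class i ↭ B × Separating B)
      ordered i = separatingOrder (class i) (class-independent i)
      line : Fin (suc Δ) → List Vertex
      line i = proj₁ (ordered i)
      good : ∀ i → Separating (line i)
      good i = proj₂ (proj₂ (ordered i))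
      independent : ∀ i → Independent (line i)
      independent i = independent-↭ (proj₁ (proj₂ (ordered i))) (class-independent i)
      ∈line : ∀ w → w ∈ line (color w)
      ∈line w = ∈-resp-↭ (proj₁ (proj₂ (ordered (color w))))
        (∈-filter⁺ (λ v → color v ≟ color w) (∈-allFin w) refl)

-- Dedekind real numbers.

rational : ℚ → ℝ
rational x = record
  { Lower          = ℚ._< x
  ; Upper          = x ℚ.<_
  ; lower-nonempty = x ℚ.- ℚ.1ℚ , x-1<x
  ; upper-nonempty = x ℚ.+ ℚ.1ℚ , x<x+1
  ; lower-closed   = ℚ.<-trans
  ; upper-closed   = λ q<r x<q → ℚ.<-trans x<q q<r
  ; lower-open     = λ q<x → let r , q<r , r<x = ℚ.<-dense q<x in r , q<r , r<x
  ; upper-open     = λ x<r → let q , x<q , q<r = ℚ.<-dense x<r in q , q<r , x<q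
  ; disjoint       = λ (q<x , x<q) → ℚ.<-asym q<x x<q
  ; located        = located
  }
  where
  x-1<x : x ℚ.- ℚ.1ℚ ℚ.< x
  x-1<x = subst (x ℚ.- ℚ.1ℚ ℚ.<_) (ℚ.+-identityʳ x)
    (ℚ.+-monoʳ-< x {ℚ.- ℚ.1ℚ} {ℚ.0ℚ} (toWitness {a? = ℚ.- ℚ.1ℚ ℚ.<? ℚ.0ℚ} _))
  x<x+1 : x ℚ.< x ℚ.+ ℚ.1ℚ
  x<x+1 = subst (ℚ._< x ℚ.+ ℚ.1ℚ) (ℚ.+-identityʳ x)
    (ℚ.+-monoʳ-< x {ℚ.0ℚ} {ℚ.1ℚ} (toWitness {a? = ℚ.0ℚ ℚ.<? ℚ.1ℚ} _))
  located : ∀ {q r} → q ℚ.< r → q ℚ.< x ⊎ x ℚ.< r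
  located {q} q<r with q ℚ.<? x
  ... | yes q<x = inj₁ q<x
  ... | no q≮x  = inj₂ (ℚ.≤-<-trans (ℚ.≮⇒≥ q≮x) q<r)

fromℕ : ℕ → ℚ
fromℕ n = mkℚ (+ n) 0 (Coprimality.sym (1-coprimeTo n))

fromℕ-mono-< : ∀ {m n} → m < n → fromℕ m ℚ.< fromℕ n
fromℕ-mono-< {m} {n} m<n = *<*
  (subst₂ ℤ._<_ (sym (ℤ.*-identityʳ (+ m))) (sym (ℤ.*-identityʳ (+ n))) (ℤ.+<+ m<n))

natural : ℕ → ℝ
natural n = rational (fromℕ n)

natural-mono-≤ : ∀ {m n} → m ≤ n → natural m ≤ℝ natural n
natural-mono-≤ {m} {n} m≤n q<m with ℕ.m≤n⇒m<n∨m≡n m≤n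
... | inj₁ m<n  = ℚ.<-trans q<m (fromℕ-mono-< m<n)
... | inj₂ refl = q<m

natural-cancel-≤ : ∀ {m n} → natural m ≤ℝ natural n → m ≤ n
natural-cancel-≤ {m} {n} m≤n = ℕ.≮⇒≥ λ n<m → ℚ.<-irrefl refl (m≤n (fromℕ-mono-< n<m))

infix 4 _<ℝ_

_<ℝ_ : ℝ → ℝ → Set
x <ℝ y = ∃[ q ] (ℝ.Upper x q × ℝ.Lower y q)

<⇒≱ℝ : ∀ {x y} → x <ℝ y → ¬ (y ≤ℝ x)
<⇒≱ℝ {x} (q , x<q , q<y) y≤x = ℝ.disjoint x (y≤x q<y , x<q)

-- Openness moves q up to some r below y; locatedness of x between q and r leaves only q < x, since
-- x < r < y is excluded.
≮⇒≥ℝ : ∀ {x y} → ¬ (x <ℝ y) → y ≤ℝ x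
≮⇒≥ℝ {x} {y} x≮y q<y with ℝ.lower-open y q<y
... | r , q<r , r<y with ℝ.located x q<r
...   | inj₁ q<x = q<x
...   | inj₂ x<r = contradiction (r , x<r , r<y) x≮y

<ℝ-ferrers : ∀ {x y x′ y′} → x <ℝ y → x′ <ℝ y′ → x <ℝ y′ ⊎ x′ <ℝ y
<ℝ-ferrers {x} {x′ = x′} (q , x<q , q<y) (q′ , x′<q′ , q′<y′) with ℚ.<-cmp q q′
... | tri< q<q′ _ _ = inj₁ (q′ , ℝ.upper-closed x q<q′ x<q , q′<y′)
... | tri≈ _ refl _ = inj₁ (q′ , x<q , q′<y′)
... | tri> _ _ q′<q = inj₂ (q , ℝ.upper-closed x′ q′<q x′<q′ , q<y)

_⊔ℝ_ : ℝ → ℝ → ℝ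
x ⊔ℝ y = record
  { Lower          = λ q → X.Lower q ⊎ Y.Lower q
  ; Upper          = λ q → X.Upper q × Y.Upper q
  ; lower-nonempty = map₂ inj₁ X.lower-nonempty
  ; upper-nonempty = upper-nonempty
  ; lower-closed   = λ q<r → Sum.map (X.lower-closed q<r) (Y.lower-closed q<r)
  ; upper-closed   = λ q<r (a , b) → X.upper-closed q<r a , Y.upper-closed q<r b
  ; lower-open     = [ (λ l → map₂ (map₂ inj₁) (X.lower-open l))
                     , (λ l → map₂ (map₂ inj₂) (Y.lower-open l)) ]′
  ; upper-open     = upper-open
  ; disjoint       = λ { (inj₁ l , u , _) → X.disjoint (l , u)
                       ; (inj₂ l , _ , u) → Y.disjoint (l , u) }
  ; located        = located
  }
  where
  module X = ℝ x
  module Y = ℝ y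
  -- The larger rational is returned with its origin, so that `upper-open` can keep the strict bound
  -- it had.
  common : ∀ {q r} → X.Upper q → Y.Upper r → ∃[ s ] ((s ≡ q ⊎ s ≡ r) × X.Upper s × Y.Upper s)
  common {q} {r} x<q y<r with ℚ.<-cmp q r
  ... | tri< q<r _ _  = r , inj₂ refl , X.upper-closed q<r x<q , y<r
  ... | tri≈ _ refl _ = r , inj₂ refl , x<q , y<r
  ... | tri> _ _ r<q  = q , inj₁ refl , x<q , Y.upper-closed r<q y<r
  upper-nonempty : ∃[ q ] (X.Upper q × Y.Upper q)
  upper-nonempty with common (proj₂ X.upper-nonempty) (proj₂ Y.upper-nonempty)
  ... | s , _ , u = s , u
  upper-open : ∀ {r} → X.Upper r × Y.Upper r → ∃[ q ] (q ℚ.< r × X.Upper q × Y.Upper q)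
  upper-open (x<r , y<r) with X.upper-open x<r | Y.upper-open y<r
  ... | q , q<r , x<q | q′ , q′<r , y<q′ with common x<q y<q′
  ...   | s , inj₁ refl , u = s , q<r , u
  ...   | s , inj₂ refl , u = s , q′<r , u
  located : ∀ {q r} → q ℚ.< r → (X.Lower q ⊎ Y.Lower q) ⊎ (X.Upper r × Y.Upper r)
  located q<r with X.located q<r | Y.located q<r
  ... | inj₁ l | _      = inj₁ (inj₁ l)
  ... | inj₂ _ | inj₁ l = inj₁ (inj₂ l)
  ... | inj₂ u | inj₂ v = inj₂ (u , v)

-- Covers and box representations.

module _ (G : Graph) where

  open Graph G

  -- In each coordinate, u precedes w when the interval of u ends before that of w begins. This
  -- relation on reals need not be decidable, whence the double negation.
  representable⇒¬¬coverable : ∀ {c} → BoxRepresentable G c → ¬ ¬ Coverable G c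
  representable⇒¬¬coverable {c} (B , rep) ¬cov =
    ¬¬-∀Fin (λ i → ¬¬-∀Fin λ u → ¬¬-∀Fin λ w → ¬¬-excluded-middle) λ dec →
    ¬cov (isCover⇒coverable G dec record
      { sound    = sound
      ; ferrers  = λ i u w u′ w′ → <ℝ-ferrers {hi u i} {lo w i} {hi u′ i} {lo w′ i}
      ; complete = λ u w u≢w u≁w →
          decidable-stable (Fin.any? λ i → dec i u w ⊎-dec dec i w u) λ ∄i →
            u≁w (Equivalence.from (rep u w u≢w) (meet u w ∄i))
      })
    where
    lo hi : Vertex → Fin c → ℝ
    lo u = Box.lo (B u)
    hi u = Box.hi (B u)
    _precedes_at_ : Vertex → Vertex → Fin c → Set
    u precedes w at i = hi u i <ℝ lo w i
    sound : ∀ i u w → u precedes w at i → u ≢ w × ¬ (u ~ w)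
    sound i u w u<w = u≢w , λ u~w →
      let p , p∈u , p∈w = Equivalence.to (rep u w u≢w) u~w
      in <⇒≱ℝ {hi u i} {lo w i} u<w (proj₂ (p∈u i) ∘ proj₁ (p∈w i))
      where
      u≢w : u ≢ w
      u≢w refl = <⇒≱ℝ {hi u i} {lo u i} u<w (Box.lo≤hi (B u) i)
    meet : ∀ u w → ¬ (∃[ i ] (u precedes w at i ⊎ w precedes u at i)) → Intersect (B u) (B w)
    -- If neither box precedes the other in any coordinate, the larger left end lies in both
    -- intervals.
    meet u w ∄i = (λ i → lo u i ⊔ℝ lo w i)
      , (λ i → inj₁ , [ Box.lo≤hi (B u) i , ≮⇒≥ℝ {hi u i} {lo w i} (λ p → ∄i (i , inj₁ p)) ]′)
      , (λ i → inj₂ , [ ≮⇒≥ℝ {hi w i} {lo u i} (λ p → ∄i (i , inj₂ p)) , Box.lo≤hi (B w) i ]′)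

  coverable⇒representable : ∀ {c} → Coverable G c → BoxRepresentable G c
  coverable⇒representable {c} (M , cov) = box , λ u w u≢w → mk⇔ (meet u w u≢w) (adjacent u w u≢w)
    where
    open IsCover cov
    P = entry G M
    P? = entry? G M
    count : {Q : Vertex → Set} → Decidable Q → ℕ
    count Q? = length (filter Q? (allFin order))
    -- The right end of u is given by the intersection of the down-sets of all w above u,
    -- with u itself removed so that it falls short of the left end of every such w.
    Below : Fin c → Vertex → Vertex → Set
    Below i u x = x ≢ u × (∀ w → P i u w → P i x w)
    below? : ∀ i u → Decidable (Below i u)
    below? i u x = ¬? (x ≟ u) ×-dec Fin.all? λ w → P? i u w →-dec P? i x w
    lo hi : Fin c → Vertex → ℕ
    lo i u = count (λ x → P? i x u)
    hi i u = count (below? i u)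
    hi<lo : ∀ {i u w} → P i u w → hi i u < lo i w
    hi<lo {i} {u} {w} p = length-filter-mono-< (below? i u) (λ x → P? i x w) (allFin order)
      (λ _ (_ , b) → b w p) (∈-allFin u) (λ (u≢u , _) → u≢u refl) p
    -- By the Ferrers property, anything below w is below every w′ above u, because u is not below
    -- w.
    lo≤hi : ∀ {i u w} → ¬ P i u w → lo i w ≤ hi i u
    lo≤hi {i} {u} {w} ¬p = length-filter-mono-≤ (λ x → P? i x w) (below? i u) (allFin order)
      λ {x} _ Pxw → (λ { refl → ¬p Pxw })
        , λ w′ Puw′ → [ id , (λ Puw → contradiction Puw ¬p) ]′ (ferrers i x w u w′ Pxw Puw′)
    box : Vertex → Box c
    box u = record
      { lo    = λ i → natural (lo i u)
      ; hi    = λ i → natural (hi i u)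
      ; lo≤hi = λ i → natural-mono-≤ (lo≤hi λ p → proj₁ (sound i u u p) refl)
      }
    meet : ∀ u w → u ≢ w → u ~ w → Intersect (box u) (box w)
    meet u w u≢w u~w = (λ i → natural (lo i u ⊔ lo i w))
      , (λ i → natural-mono-≤ (ℕ.m≤m⊔n _ _)
             , natural-mono-≤ (ℕ.⊔-lub (lo≤hi (λ p → proj₁ (sound i u u p) refl))
                                       (lo≤hi (λ p → proj₂ (sound i u w p) u~w))))
      , (λ i → natural-mono-≤ (ℕ.m≤n⊔m (lo i u) _)
             , natural-mono-≤ (ℕ.⊔-lub (lo≤hi (λ p → proj₂ (sound i w u p) (~-sym u~w)))
                                       (lo≤hi (λ p → proj₁ (sound i w w p) refl))))
    disjoint : ∀ {i u w} → P i u w → ¬ Intersect (box u) (box w)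
    disjoint {i} {u} {w} p (x , x∈u , x∈w) =
      <⇒≱ (hi<lo {i} p) (natural-cancel-≤ (proj₂ (x∈u i) ∘ proj₁ (x∈w i)))
    adjacent : ∀ u w → u ≢ w → Intersect (box u) (box w) → u ~ w
    adjacent u w u≢w (x , x∈u , x∈w) = decidable-stable (u ~? w) λ u≁w →
      case complete u w u≢w u≁w of λ
        { (i , inj₁ p) → disjoint p (x , x∈u , x∈w)
        ; (i , inj₂ p) → disjoint p (x , x∈w , x∈u) }

-- Boxicity and the final bound.

-- The minimum is taken over the decidable `Coverable`. A representation gives a cover only under
-- double negation, which suffices for the decidable inequality b ≤ c.
coverable⇒boxicity≤ : (G : Graph) → ∀ k → Coverable G k → ∃[ b ] (IsBoxicity G b × b ≤ k)
coverable⇒boxicity≤ G k cov with least (coverable? G) k cov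
... | b , cov-b , b≤k , minimal = b
    , (coverable⇒representable G cov-b , λ c rep →
        decidable-stable (b ≤? c) (¬¬-map (minimal c) (representable⇒¬¬coverable G rep)))
    , b≤k

≤1-vertex⇒coverable : (G : Graph) → Graph.order G ≤ 1 → Coverable G 0
≤1-vertex⇒coverable G n≤1 = [] , record
  { sound    = λ ()
  ; ferrers  = λ ()
  ; complete = λ u w u≢w → contradiction (unique n≤1 u w) u≢w
  }
  where
  unique : ∀ {n} → n ≤ 1 → (u w : Fin n) → u ≡ w
  unique (s≤s z≤n) zero zero = refl

-- The condition on Δ excludes edgeless graphs with at least two vertices: they have Δ = 0 but, not
-- being complete, positive boxicity.
theorem7 : (G : Graph) → Graph.ATFree G → (2 ≤ Graph.order G → 1 ≤ Graph.Δ G) → ∃[ b ] (IsBoxicity G b × b ≤ 3 * Graph.Δ G)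
theorem7 G atfree Δ≥1 with 2 ≤? Graph.order G
-- At most one vertex: the graph is complete and dimension 0 suffices.
... | no n≱2 = map₂ (map₂ (λ b≤0 → ≤-trans b≤0 z≤n))
      (coverable⇒boxicity≤ G 0 (≤1-vertex⇒coverable G (≤-pred (ℕ.≰⇒> n≱2))))
... | yes n≥2 = map₂ (map₂ (λ b≤ → ≤-trans b≤ (1+Δ≤3Δ (Δ≥1 n≥2))))
      (coverable⇒boxicity≤ G (suc (Graph.Δ G)) (atfree⇒coverable G atfree))
  where
  1+Δ≤3Δ : ∀ {d} → 1 ≤ d → suc d ≤ 3 * d
  1+Δ≤3Δ {d} 1≤d = ℕ.+-mono-≤ 1≤d (ℕ.m≤m+n d (d + 0))
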